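{- Let $\mathcal{A}$ be a finite set of at least 3 alternatives, $N\ge2$, $i\in\{1,\dots,N\}$, and $w:\underline{\mathcal{P}}^N\to\underline{\mathcal{P}}$ satisfy Unanimity, IIA and Non-Dictatorship. Then the self-reference system $(w,\Omega_i)$ with valid elements $\mathcal{P}^N$ is quasi-Gödelian with respect to $\Upsilon_i=(\mathbf{c},\dots,\mathbf{i},\dots,\mathbf{c})$: there exists $q\in\mathcal{P}^N$ with $q\le\neg(\Upsilon_i\ast q)$ such that $(\Upsilon_i,q)$ does not satisfy both quasi-consistency $q\le\neg(\Upsilon_i\ast\neg q)$ and quasi-completeness ($\neg(\Upsilon_i\ast q)$ and $\neg(\Upsilon_i\ast\neg q)$ are inconsistent).
   Context: $\mathcal{P}$: weak orders on $\mathcal{A}$; $\underline{\mathcal{P}}=\mathcal{P}\cup\{\mathbf{c}\}$, $\mathbf{c}$ a new element (contradictory preference cycle). Strictness order: $r\le s$ iff every strict preference of $s$ is one of $r$; $\mathbf{c}$ bottom, $\mathbf{i}$ (total indifference) top; $\wedge,\vee$ meet and join; negation $\neg\mathbf{c}=\mathbf{i}$, $\neg\mathbf{i}=\mathbf{c}$, and otherwise $\neg r$ reverses all strict preferences of $r$. On $\underline{\mathcal{P}}^N$ all operations and the order are coordinatewise; $\mathcal{P}^N$ are the valid profiles, and $p,q$ are inconsistent if $p_j\wedge q_j=\mathbf{c}$ for some $j$. $\Omega_i((p_1,\dots,p_N),r)=(\mathbf{c},\dots,p_i\wedge r,\dots,\mathbf{c})$ (position $i$), and $e\ast f:=\Omega_i(e,w(f))$;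 $\neg\Upsilon\ast d$ means $\neg(\Upsilon\ast d)$. Unanimity: if all individuals of $p\in\mathcal{P}^N$ strictly prefer $a$ to $b$, so does $w(p)$. IIA: the aggregate comparison of $a,b$ depends only on individuals' comparisons of $a,b$ (for these axioms $\mathbf{c}$ is read as a preference cycle, i.e. an intransitive assignment of pairwise comparisons). Dictator at $j$: for all $p\in\mathcal{P}^N$, $w(p)=\mathbf{c}\Rightarrow p_j=\mathbf{i}$ and $p_j\ne\mathbf{i}\Rightarrow w(p)\le p_j$. Non-Dictatorship: no dictator. -}

module Defs where

open import Data.Fin using (Fin)
open import Data.Fin.Properties using () renaming (all? to allFin?)
open import Data.Nat using (ℕ)
open import Data.Product using (_×_; _,_; proj₁; proj₂; ∃-syntax)
open import Data.Sum using (_⊎_; inj₁; inj₂; swap)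
open import Data.Unit using (⊤; tt)
open import Data.Vec.Functional using (Vector; map; replicate; updateAt)
open import Data.Vec.Functional.Relation.Binary.Pointwise using (Pointwise)
import Data.Vec.Functional.Relation.Binary.Equality.Setoid as VectorEquality
open import Function using (_↔_; Inverse; _⇔_; mk⇔; Equivalence; Func; _⟶ₛ_; const; flip)
open import Level using (0ℓ)
import Relation.Binary.Construct.Add.Infimum.Equality as AddEquality
import Relation.Binary.Construct.Add.Infimum.NonStrict as AddNonStrict
open import Relation.Binary using
  (Rel; Setoid; IsEquivalence; IsTotalPreorder; IsPartialOrder;
   Decidable; Total; Transitive; Antisymmetric; Maximum)
open import Relation.Binary.Lattice.Definitions using (Infimum)
open import Relation.Binary.PropositionalEquality using (_≡_; refl; subst; isEquivalence)
open import Relation.Nullary using (¬_; Dec; yes; no; contradiction)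
open import Relation.Nullary.Construct.Add.Infimum using (_₋; ⊥₋; [_])
open import Relation.Nullary.Decidable using (map′; _×-dec_; _⊎-dec_)
import Relation.Unary as U

-- `a ≽ b` reads "a is at least as good as b".  Transitivity is not required:
-- a preference cycle is a complete assignment of comparisons that is not transitive.
record Comparisons (A : Set) : Set₁ where
  infix 4 _≽_ _≽?_ _≻_
  field
    _≽_   : Rel A 0ℓ
    total : Total _≽_
    _≽?_  : Decidable _≽_

  _≻_ : Rel A 0ℓ
  a ≻ b = a ≽ b × ¬ (b ≽ a)

  ⋡⇒≻ : ∀ {a b} → ¬ (a ≽ b) → b ≻ a
  ⋡⇒≻ {a} {b} a⋡b with total a b
  ... | inj₁ a≽b = contradiction a≽b a⋡b
  ... | inj₂ b≽a = b≽a , a⋡b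

record WeakOrder (A : Set) : Set₁ where
  infix 4 _≽_ _≽?_
  field
    _≽_             : Rel A 0ℓ
    isTotalPreorder : IsTotalPreorder _≡_ _≽_
    _≽?_            : Decidable _≽_

  open IsTotalPreorder isTotalPreorder public using (total; trans)

  comparisons : Comparisons A
  comparisons = record { _≽_ = _≽_ ; total = total ; _≽?_ = _≽?_ }

  open Comparisons comparisons public using (_≻_; ⋡⇒≻)

open WeakOrder using (comparisons)

mkWeakOrder : ∀ {A} (_≽_ : Rel A 0ℓ) → Total _≽_ → Transitive _≽_ → Decidable _≽_ → WeakOrder A
mkWeakOrder _≽_ total trans _≽?_ = record
  { _≽_             = _≽_
  ; isTotalPreorder = record
    { isPreorder = record
      { isEquivalence = isEquivalence
      ; reflexive     = λ { {a} refl → reflexive (total a a) }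
      ; trans         = trans
      }
    ; total = total
    }
  ; _≽?_ = _≽?_
  }
  where
  reflexive : ∀ {a} → a ≽ a ⊎ a ≽ a → a ≽ a
  reflexive (inj₁ a≽a) = a≽a
  reflexive (inj₂ a≽a) = a≽a

SameComparison : ∀ {A} → Comparisons A → Comparisons A → Rel A 0ℓ
SameComparison R S a b = (a R.≽ b ⇔ a S.≽ b) × (b R.≽ a ⇔ b S.≽ a)
  where
  module R = Comparisons R
  module S = Comparisons S

module _ {A : Set} where

  infix 4 _≃_ _≼_

  _≃_ : Rel (WeakOrder A) 0ℓ
  r ≃ s = ∀ a b → a r.≽ b ⇔ a s.≽ b
    where
    module r = WeakOrder r
    module s = WeakOrder s

  ≃-isEquivalence : IsEquivalence _≃_
  ≃-isEquivalence = record
    { refl  = λ a b → mk⇔ (λ x → x) (λ x → x)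
    ; sym   = λ r≃s a b → mk⇔ (from (r≃s a b)) (to (r≃s a b))
    ; trans = λ r≃s s≃t a b → mk⇔ (λ x → to (s≃t a b) (to (r≃s a b) x))
                                  (λ x → from (r≃s a b) (from (s≃t a b) x))
    }
    where open Equivalence using (to; from)

  _≼_ : Rel (WeakOrder A) 0ℓ
  r ≼ s = ∀ {a b} → a s.≻ b → a r.≻ b
    where
    module r = WeakOrder r
    module s = WeakOrder s

  ≼-antisym : Antisymmetric _≃_ _≼_
  ≼-antisym {r} {s} r≼s s≼r a b = mk⇔ (half r s r≼s) (half s r s≼r)
    where
    open WeakOrder
    half : ∀ r s → r ≼ s → _≽_ r a b → _≽_ s a b
    half r s r≼s a≽b with _≽?_ s a b
    ... | yes p = p
    ... | no ¬p = contradiction a≽b (proj₂ (r≼s (⋡⇒≻ s ¬p)))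

  ≼-isPartialOrder : IsPartialOrder _≃_ _≼_
  ≼-isPartialOrder = record
    { isPreorder = record
      { isEquivalence = ≃-isEquivalence
      ; reflexive     = λ {r} {s} r≃s {a} {b} (a≽b , b⋡a) →
          from (r≃s a b) a≽b , λ b≽a → b⋡a (to (r≃s b a) b≽a)
      ; trans         = λ r≼s s≼t a≻b → r≼s (s≼t a≻b)
      }
    ; antisym = λ {r} {s} → ≼-antisym {r} {s}
    }
    where open Equivalence using (to; from)

-- Weak orders together with the contradictory element 𝐜.
P̲ : Set → Set₁
P̲ A = WeakOrder A ₋

pattern 𝐜 = ⊥₋

module _ {A : Set} where

  open AddEquality (_≃_ {A}) public
    using () renaming (_≈₋_ to _≈_; ≈₋-isEquivalence to liftEquivalence)
  open AddNonStrict (_≼_ {A}) public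
    using () renaming (_≤₋_ to _≤_; ≤₋-isPartialOrder to liftPartialOrder;
                       ⊥₋≤_ to 𝐜≤_; [_] to ≤[_])

  P̲-setoid : Setoid _ _
  P̲-setoid = record { isEquivalence = liftEquivalence ≃-isEquivalence }

  ≤-isPartialOrder : IsPartialOrder _≈_ _≤_
  ≤-isPartialOrder = liftPartialOrder ≼-isPartialOrder

  indifference : WeakOrder A
  indifference = mkWeakOrder (λ _ _ → ⊤) (λ _ _ → inj₁ tt) _ (λ _ _ → yes tt)

  𝐢 : P̲ A
  𝐢 = [ indifference ]

  reverse : WeakOrder A → WeakOrder A
  reverse r = mkWeakOrder (flip _≽_) (flip total) (flip trans) (flip _≽?_)
    where open WeakOrder r

  𝐢-maximum : Maximum _≤_ 𝐢
  𝐢-maximum 𝐜     = 𝐜≤ 𝐢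
  𝐢-maximum [ r ] = ≤[ (λ (_ , b⋡a) → contradiction tt b⋡a) ]

module Lattice {A : Set} {n : ℕ} (finite : A ↔ Fin n) where

  open Inverse finite using (to; from; strictlyInverseʳ)

  all? : ∀ {ℓ} {P : A → Set ℓ} → U.Decidable P → Dec (∀ a → P a)
  all? {P = P} P? = map′
    (λ Pf a → subst P (strictlyInverseʳ a) (Pf (to a)))
    (λ Pa x → Pa (from x))
    (allFin? (λ x → P? (from x)))

  private
    all₂? : {R : Rel A 0ℓ} → Decidable R → Dec (∀ a b → R a b)
    all₂? R? = all? λ a → all? λ b → R? a b

  indifferent? : (r : WeakOrder A) → Dec (∀ a b → WeakOrder._≽_ r a b)
  indifferent? r = all₂? (WeakOrder._≽?_ r)

  infix 8 ~_
  ~_ : P̲ A → P̲ A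
  ~ 𝐜 = 𝐢
  ~ [ r ] with indifferent? r
  ... | yes _ = 𝐜
  ... | no  _ = [ reverse r ]

  Common : WeakOrder A → WeakOrder A → Rel A 0ℓ
  Common r s a b = WeakOrder._≽_ r a b × WeakOrder._≽_ s a b

  common? : ∀ r s → Decidable (Common r s)
  common? r s a b = WeakOrder._≽?_ r a b ×-dec WeakOrder._≽?_ s a b

  commonTotal? : ∀ r s → Dec (Total (Common r s))
  commonTotal? r s = all₂? λ a b → common? r s a b ⊎-dec common? r s b a

  -- If two weak orders have any common lower bound, the greatest one has
  -- their strict preferences combined, i.e. the intersection of the two
  -- weak preference relations; see ∧-infimum.
  infixr 7 _∧_
  _∧_ : P̲ A → P̲ A → P̲ A
  𝐜     ∧ _     = 𝐜
  [ _ ] ∧ 𝐜     = 𝐜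
  [ r ] ∧ [ s ] with commonTotal? r s
  ... | yes tot = [ mkWeakOrder (Common r s) tot
                     (λ (p , q) (p′ , q′) → r.trans p p′ , s.trans q q′)
                     (common? r s) ]
    where
    module r = WeakOrder r
    module s = WeakOrder s
  ... | no _    = 𝐜

  ∧-infimum : Infimum _≤_ _∧_
  ∧-infimum 𝐜     y = 𝐜≤ 𝐜 , 𝐜≤ y , λ z z≤𝐜 _ → z≤𝐜
  ∧-infimum [ r ] 𝐜 = 𝐜≤ [ r ] , 𝐜≤ 𝐜 , λ z _ z≤𝐜 → z≤𝐜
  ∧-infimum [ r ] [ s ] with commonTotal? r s
  ... | yes tot = ≤[ (λ a≻b → lowerʳ a≻b) ] , ≤[ (λ a≻b → lowerˢ a≻b) ] , greatest
    where
    module r = WeakOrder r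
    module s = WeakOrder s
    lowerʳ : ∀ {a b} → a r.≻ b → Common r s a b × ¬ Common r s b a
    lowerʳ {a} {b} (_ , b⋡a) with tot a b
    ... | inj₁ ab = ab , λ ba → b⋡a (proj₁ ba)
    ... | inj₂ ba = contradiction (proj₁ ba) b⋡a
    lowerˢ : ∀ {a b} → a s.≻ b → Common r s a b × ¬ Common r s b a
    lowerˢ {a} {b} (_ , b⋡a) with tot a b
    ... | inj₁ ab = ab , λ ba → b⋡a (proj₂ ba)
    ... | inj₂ ba = contradiction (proj₂ ba) b⋡a
    greatest : ∀ z → z ≤ [ r ] → z ≤ [ s ] → z ≤ [ _ ]
    greatest 𝐜     _        _        = 𝐜≤ _
    greatest [ t ] ≤[ t≼r ] ≤[ t≼s ] = ≤[ below ]
      where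
      module t = WeakOrder t
      below : ∀ {a b} → Common r s a b × ¬ Common r s b a → a t.≻ b
      below {a} {b} ((p , q) , ¬ba) with b r.≽? a
      ... | no  b⋡a = t≼r (p , b⋡a)
      ... | yes b≽a = t≼s (q , λ b≽ₛa → ¬ba (b≽a , b≽ₛa))
  ... | no ¬tot = 𝐜≤ [ r ] , 𝐜≤ [ s ] , greatest
    where
    greatest : ∀ z → z ≤ [ r ] → z ≤ [ s ] → z ≤ 𝐜
    greatest 𝐜     _        _        = 𝐜≤ 𝐜
    greatest [ t ] ≤[ t≼r ] ≤[ t≼s ] = contradiction tot ¬tot
      where
      module t = WeakOrder t
      weak : ∀ u → t ≼ u → ∀ {a b} → a t.≽ b → WeakOrder._≽_ u a b
      weak u t≼u {a} {b} a≽b with WeakOrder._≽?_ u a b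
      ... | yes p = p
      ... | no ¬p = contradiction a≽b (proj₂ (t≼u (WeakOrder.⋡⇒≻ u ¬p)))
      tot : Total (Common r s)
      tot a b with t.total a b
      ... | inj₁ p = inj₁ (weak r t≼r p , weak s t≼s p)
      ... | inj₂ p = inj₂ (weak r t≼r p , weak s t≼s p)

Profile : Set → ℕ → Set₁
Profile A N = Vector (P̲ A) N

ValidProfile : Set → ℕ → Set₁
ValidProfile A N = Vector (WeakOrder A) N

valid : ∀ {A N} → ValidProfile A N → Profile A N
valid = map [_]

Profile-setoid : Set → ℕ → Setoid _ _
Profile-setoid A = VectorEquality.≋-setoid (P̲-setoid {A})

Aggregation : Set → ℕ → Set₁
Aggregation A N = Profile-setoid A N ⟶ₛ P̲-setoid {A}

module _ {A : Set} {N : ℕ} where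

  -- As an aggregate outcome, 𝐜 stands for some preference cycle.
  Represents : Comparisons A → P̲ A → Set
  Represents R 𝐜     = ¬ Transitive (Comparisons._≽_ R)
  Represents R [ r ] = ∀ a b → SameComparison R (comparisons r) a b

  record Reading (w : Aggregation A N) : Set₁ where
    field
      outcome    : ValidProfile A N → Comparisons A
      represents : ∀ p → Represents (outcome p) (Func.to w (valid p))

  module _ {w : Aggregation A N} (ρ : Reading w) where

    open Reading ρ

    Unanimity : Set₁
    Unanimity = ∀ p a b →
      (∀ j → WeakOrder._≻_ (p j) a b) → Comparisons._≻_ (outcome p) a b

    IIA : Set₁
    IIA = ∀ p p′ a b →
      (∀ j → SameComparison (comparisons (p j)) (comparisons (p′ j)) a b) →
      SameComparison (outcome p) (outcome p′) a b

  module _ (w : Aggregation A N) where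

    open Func w using (to)

    Dictator : Fin N → Set₁
    Dictator j = ∀ (p : ValidProfile A N) →
      (to (valid p) ≈ 𝐜 → valid p j ≈ 𝐢) ×
      (¬ (valid p j ≈ 𝐢) → to (valid p) ≤ valid p j)

    NonDictatorship : Set₁
    NonDictatorship = ¬ (∃[ j ] Dictator j)

module SelfReference {A : Set} {n : ℕ} (finite : A ↔ Fin n) {N : ℕ} where

  open Lattice finite

  infix 4 _≤ᴺ_
  _≤ᴺ_ : Rel (Profile A N) _
  _≤ᴺ_ = Pointwise _≤_

  infix 8 ~ᴺ_
  ~ᴺ_ : Profile A N → Profile A N
  ~ᴺ_ = map ~_

  Inconsistent : Rel (Profile A N) _
  Inconsistent p q = ∃[ j ] (p j ∧ q j) ≈ 𝐜

  Ω : Fin N → Profile A N → P̲ A → Profile A N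
  Ω i p r = updateAt (replicate N 𝐜) i (const (p i ∧ r))

  Υ : Fin N → Profile A N
  Υ i = updateAt (replicate N 𝐜) i (const 𝐢)

  module _ (w : Aggregation A N) (Ω : Profile A N → P̲ A → Profile A N) where

    infixl 9 _∗_
    _∗_ : Profile A N → Profile A N → Profile A N
    e ∗ f = Ω e (Func.to w f)

    QuasiConsistent : Rel (Profile A N) _
    QuasiConsistent e q = q ≤ᴺ ~ᴺ (e ∗ (~ᴺ q))

    QuasiComplete : Rel (Profile A N) _
    QuasiComplete e q = Inconsistent (~ᴺ (e ∗ q)) (~ᴺ (e ∗ (~ᴺ q)))

    QuasiGödelian : Profile A N → Set₁
    QuasiGödelian e = ∃[ q ] valid q ≤ᴺ ~ᴺ (e ∗ valid q) ×
      ¬ (QuasiConsistent e (valid q) × QuasiComplete e (valid q))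

{-# OPTIONS --safe #-}

-- If q is valid and q ≤ ¬(Υ ∗ q), then quasi-consistency makes q a common
-- lower bound of ¬(Υ ∗ q) and ¬(Υ ∗ ¬q), so these are consistent and
-- quasi-completeness fails.  If w(q) = 𝐜 then ¬(Υ ∗ q) is 𝐢 everywhere, so it
-- remains to find a valid q with w(q) = 𝐜.  Up to ≃ there are finitely many
-- valid profiles, so such a q can be searched for; if there were none, all
-- outcomes would be transitive and Arrow's theorem would yield a dictator.

module Submission where

open import Defs using (Aggregation; Reading; Unanimity; IIA; NonDictatorship; module SelfReference)
open import Defs using
  (Comparisons; WeakOrder; mkWeakOrder; SameComparison; ValidProfile; valid;
   P̲; 𝐜; 𝐢; _≃_; _≈_; 𝐜≤_; ≤[_]; 𝐢-maximum; ≤-isPartialOrder;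
   ≃-isEquivalence; liftEquivalence; indifference; reverse;
   Dictator; module Lattice)
import Defs
open import Data.Bool using (Bool; T; T?; if_then_else_)
open import Data.Fin using (Fin; zero; combine; remQuot; punchIn; punchOut)
open import Data.Fin.Properties using
  (_≟_; remQuot-combine; punchInᵢ≢i; punchIn-injective; punchIn-punchOut)
open import Data.Fin.Subset using (Subset)
open import Data.Fin.Subset.Properties using (anySubset?)
open import Data.List using ([]; _∷_; allFin)
open import Data.List.Membership.Propositional using (_∈_)
open import Data.List.Membership.Propositional.Properties using (∈-allFin)
open import Data.List.Relation.Unary.Any using (here; there)
import Data.List.Membership.DecPropositional as DecMembership
open import Data.Nat using (ℕ; _≤_; _*_; s≤s)
open import Data.Product using (_×_; _,_; proj₁; proj₂; map₂; ∃; ∃-syntax)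
open import Data.Sum using (_⊎_; inj₁; inj₂; [_,_]′)
import Data.Sum as Sum
open import Data.Vec using (lookup; tabulate)
open import Data.Vec.Properties using (lookup∘tabulate)
open import Data.Vec.Functional using (replicate)
open import Data.Vec.Functional.Properties using (updateAt-updates; updateAt-minimal)
open import Function using (_↔_; _⇔_; mk⇔; Equivalence; Inverse; Func; const; _∘_)
open import Function.Properties.Inverse using (↔⇒↣)
open import Level using (0ℓ)
open import Relation.Binary using
  (Rel; Decidable; DecidableEquality; Total; Transitive; IsEquivalence; IsPartialOrder)
open import Relation.Binary.PropositionalEquality
  using (_≡_; _≢_; refl; sym; trans; cong; cong₂; subst; ≢-sym)
import Relation.Binary.Construct.Add.Infimum.Equality as AddEquality
open import Relation.Nullary using (¬_; Dec; yes; no; does; contradiction)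
open import Relation.Nullary.Construct.Add.Infimum using ([_])
open import Relation.Nullary.Decidable using
  (map′; _×-dec_; _⊎-dec_; ¬?; ⌊_⌋; toWitness; fromWitness; via-injection)
import Relation.Unary as U

open Equivalence using (to; from)

-- Strict preference and agreement of comparisons.

module _ {A : Set} where

  module _ (R : Comparisons A) (trans′ : Transitive (Comparisons._≽_ R)) where

    open Comparisons R

    ≽-≻-trans : ∀ {a b c} → a ≽ b → b ≻ c → a ≻ c
    ≽-≻-trans a≽b (b≽c , c⋡b) = trans′ a≽b b≽c , λ c≽a → c⋡b (trans′ c≽a a≽b)

    ≻-trans : ∀ {a b c} → a ≻ b → b ≻ c → a ≻ c
    ≻-trans (a≽b , _) = ≽-≻-trans a≽b

  ≻-resp : ∀ (R S : Comparisons A) {a b} → SameComparison R S a b →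
           Comparisons._≻_ R a b → Comparisons._≻_ S a b
  ≻-resp _ _ (ab , ba) (a≽b , b⋡a) = to ab a≽b , λ b≽a → b⋡a (from ba b≽a)

  SameComparison-sym : ∀ (R S : Comparisons A) {a b} → SameComparison R S a b → SameComparison S R a b
  SameComparison-sym _ _ (ab , ba) = mk⇔ (from ab) (to ab) , mk⇔ (from ba) (to ba)

  SameComparison-flip : ∀ (R S : Comparisons A) {a b} → SameComparison R S a b → SameComparison R S b a
  SameComparison-flip _ _ (ab , ba) = ba , ab

  ≻-same : ∀ (R S : Comparisons A) {a b} → Comparisons._≻_ R a b → Comparisons._≻_ S a b →
           SameComparison R S a b
  ≻-same _ _ (r , ¬r) (s , ¬s) = mk⇔ (const s) (const r) ,
    mk⇔ (λ r′ → contradiction r′ ¬r) (λ s′ → contradiction s′ ¬s)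

  ≻-irrefl : ∀ (R : Comparisons A) {a b} → Comparisons._≻_ R a b → a ≢ b
  ≻-irrefl _ (a≽a , a⋡a) refl = a⋡a a≽a

open WeakOrder using (comparisons; _≻_)

-- Moving one alternative to the top or bottom of a weak order.

module Reorder {A : Set} (_≟ᴬ_ : DecidableEquality A) where

  promote : A → WeakOrder A → WeakOrder A
  promote x r = mkWeakOrder _≽′_ total′ trans′
    (λ a b → (a ≟ᴬ x) ⊎-dec (¬? (b ≟ᴬ x) ×-dec (a ≽? b)))
    where
    open WeakOrder r using (_≽_; _≽?_; total) renaming (trans to ≽-trans)

    _≽′_ : Rel A 0ℓ
    a ≽′ b = a ≡ x ⊎ b ≢ x × a ≽ b

    total′ : Total _≽′_
    total′ a b with a ≟ᴬ x | b ≟ᴬ x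
    ... | yes a≡x | _       = inj₁ (inj₁ a≡x)
    ... | no _    | yes b≡x = inj₂ (inj₁ b≡x)
    ... | no a≢x  | no b≢x  = Sum.map (λ a≽b → inj₂ (b≢x , a≽b)) (λ b≽a → inj₂ (a≢x , b≽a)) (total a b)

    trans′ : Transitive _≽′_
    trans′ (inj₁ a≡x)         _                  = inj₁ a≡x
    trans′ (inj₂ (b≢x , _))   (inj₁ b≡x)         = contradiction b≡x b≢x
    trans′ (inj₂ (_ , a≽b))   (inj₂ (c≢x , b≽c)) = inj₂ (c≢x , ≽-trans a≽b b≽c)

  demote : A → WeakOrder A → WeakOrder A
  demote x r = reverse (promote x (reverse r))

  module _ {x : A} (r : WeakOrder A) where

    promote-top : ∀ {a} → a ≢ x → _≻_ (promote x r) x a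
    promote-top a≢x = inj₁ refl , λ { (inj₁ a≡x) → a≢x a≡x ; (inj₂ (x≢x , _)) → x≢x refl }

    promote-same : ∀ {a b} → a ≢ x → b ≢ x → SameComparison (comparisons (promote x r)) (comparisons r) a b
    promote-same a≢x b≢x = half a≢x b≢x , half b≢x a≢x
      where
      half : ∀ {a b} → a ≢ x → b ≢ x → WeakOrder._≽_ (promote x r) a b ⇔ WeakOrder._≽_ r a b
      half a≢x b≢x = mk⇔ (λ { (inj₁ a≡x) → contradiction a≡x a≢x ; (inj₂ (_ , a≽b)) → a≽b })
                         (λ a≽b → inj₂ (b≢x , a≽b))

    promote-≻ : ∀ {a b} → a ≢ x → b ≢ x → _≻_ r a b → _≻_ (promote x r) a b
    promote-≻ a≢x b≢x =
      ≻-resp (comparisons r) (comparisons (promote x r))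
        (SameComparison-sym (comparisons (promote x r)) (comparisons r) (promote-same a≢x b≢x))

  module _ {x : A} (r : WeakOrder A) where

    demote-bottom : ∀ {a} → a ≢ x → _≻_ (demote x r) a x
    demote-bottom = promote-top (reverse r)

    demote-same : ∀ {a b} → a ≢ x → b ≢ x → SameComparison (comparisons (demote x r)) (comparisons r) a b
    demote-same a≢x b≢x = promote-same (reverse r) b≢x a≢x

    demote-≻ : ∀ {a b} → a ≢ x → b ≢ x → _≻_ r a b → _≻_ (demote x r) a b
    demote-≻ a≢x b≢x = promote-≻ (reverse r) b≢x a≢x

-- Arrow's theorem by decisive groups.

module Arrow {A : Set} (_≟ᴬ_ : DecidableEquality A)
  (third : ∀ (a b : A) → ∃[ c ] c ≢ a × c ≢ b) (a₀ : A)
  {N : ℕ} {w : Aggregation A N} (ρ : Reading w) (unanimity : Unanimity ρ) (iia : IIA ρ)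
  (transitive : ∀ p → Transitive (Comparisons._≽_ (Reading.outcome ρ p)))
  where

  open Reading ρ using (outcome)
  open Reorder _≟ᴬ_

  private
    Society : Set₁
    Society = ValidProfile A N

    _⊢_≻_ : Society → Rel A 0ℓ
    p ⊢ a ≻ b = Comparisons._≻_ (outcome p) a b

    ⊢-trans : ∀ p {a b c} → p ⊢ a ≻ b → p ⊢ b ≻ c → p ⊢ a ≻ c
    ⊢-trans p = ≻-trans (outcome p) (transitive p)

    ⊢-transfer : ∀ p p′ {a b} →
      (∀ j → SameComparison (comparisons (p j)) (comparisons (p′ j)) a b) →
      p ⊢ a ≻ b → p′ ⊢ a ≻ b
    ⊢-transfer p p′ same = ≻-resp (outcome p) (outcome p′) (iia p p′ _ _ same)

  Decisive : U.Pred (Fin N) 0ℓ → A → A → Set₁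
  Decisive G a b = ∀ p → (∀ {j} → G j → _≻_ (p j) a b) → p ⊢ a ≻ b

  -- With strict opposition outside `G`, every individual comparison of `a` and `b` is fixed; this
  -- is the form of decisiveness that a single profile can establish.
  AlmostDecisive : U.Pred (Fin N) 0ℓ → A → A → Set₁
  AlmostDecisive G a b = ∀ p →
    (∀ {j} → G j → _≻_ (p j) a b) → (∀ {j} → ¬ G j → _≻_ (p j) b a) → p ⊢ a ≻ b

  module _ {G : U.Pred (Fin N) 0ℓ} (G? : U.Decidable G) where

    -- Any two profiles in which `G` prefers `a` and all others prefer `b` agree on this pair, so
    -- IIA carries the outcome from one to the other.
    almostDecisive : ∀ p {a b} →
      (∀ {j} → G j → _≻_ (p j) a b) → (∀ {j} → ¬ G j → _≻_ (p j) b a) →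
      p ⊢ a ≻ b → AlmostDecisive G a b
    almostDecisive p {a} {b} in-p out-p a≻b p′ in-p′ out-p′ = ⊢-transfer p p′ same a≻b
      where
      same : ∀ j → SameComparison (comparisons (p j)) (comparisons (p′ j)) a b
      same j with G? j
      ... | yes g = ≻-same (comparisons (p j)) (comparisons (p′ j)) (in-p g) (in-p′ g)
      ... | no ¬g = SameComparison-flip (comparisons (p j)) (comparisons (p′ j))
                      (≻-same (comparisons (p j)) (comparisons (p′ j)) (out-p ¬g) (out-p′ ¬g))

    weaken : ∀ {a b} → Decisive G a b → AlmostDecisive G a b
    weaken dec p in-p _ = dec p in-p

    -- By IIA, y may be moved freely: above z for everybody, and below x exactly for G.
    expandʳ : ∀ {x y z} → x ≢ y → z ≢ x → z ≢ y → AlmostDecisive G x y → Decisive G x z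
    expandʳ {x} {y} {z} x≢y z≢x z≢y ad p in-p =
      ⊢-transfer p′ p same (⊢-trans p′ (ad p′ p′-in p′-out) (unanimity p′ y z y≻z))
      where
      p′ : Society
      p′ j = if does (G? j) then promote x (promote y (p j)) else promote y (p j)

      p′-in : ∀ {j} → G j → _≻_ (p′ j) x y
      p′-in {j} g with G? j
      ... | yes _ = promote-top (promote y (p j)) (≢-sym x≢y)
      ... | no ¬g = contradiction g ¬g

      p′-out : ∀ {j} → ¬ G j → _≻_ (p′ j) y x
      p′-out {j} ¬g with G? j
      ... | yes g = contradiction g ¬g
      ... | no _  = promote-top (p j) x≢y

      y≻z : ∀ j → _≻_ (p′ j) y z
      y≻z j with G? j
      ... | yes _ = promote-≻ (promote y (p j)) (≢-sym x≢y) z≢x (promote-top (p j) z≢y)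
      ... | no _  = promote-top (p j) z≢y

      same : ∀ j → SameComparison (comparisons (p′ j)) (comparisons (p j)) x z
      same j with G? j
      ... | yes g = ≻-same (comparisons (promote x (promote y (p j)))) (comparisons (p j))
                      (promote-top (promote y (p j)) z≢x) (in-p g)
      -- Outside `G` only `y` has moved, so `x` and `z` compare as in `p`, whichever way that is.
      -- Hence the conclusion is full decisiveness.
      ... | no _  = promote-same (p j) x≢y z≢y

    -- Mirror image of `expandʳ`: `x` is moved below `z` for everybody, and stays above `y` exactly
    -- for `G`, where `y` is pushed beneath it.
    expandˡ : ∀ {x y z} → x ≢ y → z ≢ x → z ≢ y → AlmostDecisive G x y → Decisive G z y
    expandˡ {x} {y} {z} x≢y z≢x z≢y ad p in-p =
      ⊢-transfer p′ p same (⊢-trans p′ (unanimity p′ z x z≻x) (ad p′ p′-in p′-out))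
      where
      p′ : Society
      p′ j = if does (G? j) then demote y (demote x (p j)) else demote x (p j)

      p′-in : ∀ {j} → G j → _≻_ (p′ j) x y
      p′-in {j} g with G? j
      ... | yes _ = demote-bottom (demote x (p j)) x≢y
      ... | no ¬g = contradiction g ¬g

      p′-out : ∀ {j} → ¬ G j → _≻_ (p′ j) y x
      p′-out {j} ¬g with G? j
      ... | yes g = contradiction g ¬g
      ... | no _  = demote-bottom (p j) (≢-sym x≢y)

      z≻x : ∀ j → _≻_ (p′ j) z x
      z≻x j with G? j
      ... | yes _ = demote-≻ (demote x (p j)) z≢y x≢y (demote-bottom (p j) z≢x)
      ... | no _  = demote-bottom (p j) z≢x

      same : ∀ j → SameComparison (comparisons (p′ j)) (comparisons (p j)) z y
      same j with G? j
      ... | yes g = ≻-same (comparisons (demote y (demote x (p j)))) (comparisons (p j))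
                      (demote-bottom (demote x (p j)) z≢y) (in-p g)
      ... | no _  = demote-same (p j) z≢x (≢-sym x≢y)

    -- One endpoint changes at a time, along the pairs `(x , y)`, `(x , c)`, `(a , c)`, `(a , z)`,
    -- `(a , b)`; the detours through `c` and `z` keep the two endpoints distinct.
    neutrality : ∀ {x y} → x ≢ y → AlmostDecisive G x y → ∀ {a b} → a ≢ b → Decisive G a b
    neutrality {x} {y} x≢y ad {a} {b} a≢b with third x a | third a b
    ... | c , c≢x , c≢a | z , z≢a , z≢b =
      -- The earlier moves may be trivial and so give only almost decisiveness; since `z` differs
      -- from `b`, this last one is a genuine expansion.
      expandʳ (≢-sym z≢a) (≢-sym a≢b) (≢-sym z≢b)
        (moveʳ (≢-sym c≢a) z≢a (moveˡ (≢-sym c≢x) (≢-sym c≢a) (moveʳ x≢y c≢x ad)))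
      where
      moveʳ : ∀ {x y z} → x ≢ y → z ≢ x → AlmostDecisive G x y → AlmostDecisive G x z
      moveʳ {x} {y} {z} x≢y z≢x ad with z ≟ᴬ y
      ... | yes refl = ad
      ... | no z≢y   = weaken (expandʳ x≢y z≢x z≢y ad)

      moveˡ : ∀ {x y z} → x ≢ y → z ≢ y → AlmostDecisive G x y → AlmostDecisive G z y
      moveˡ {x} {y} {z} x≢y z≢y ad with z ≟ᴬ x
      ... | yes refl = ad
      ... | no z≢x   = weaken (expandˡ x≢y z≢x z≢y ad)

  AllDecisive : U.Pred (Fin N) 0ℓ → Set₁
  AllDecisive G = ∀ {a b} → a ≢ b → Decisive G a b

  -- A Condorcet profile: the members of js rank c > a₀ > b, then j ranks
  -- a₀ > b > c, and everybody else b > c > a₀.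
  contract : ∀ j js → AllDecisive (_∈ j ∷ js) → AllDecisive (_≡ j) ⊎ AllDecisive (_∈ js)
  contract j js dec with DecMembership._∈?_ _≟_ j js
  ... | yes j∈js = inj₂ λ a≢b p in-p → dec a≢b p λ { (here refl) → in-p j∈js ; (there k∈js) → in-p k∈js }
  ... | no j∉js  with third a₀ a₀
  ... | b , b≢a , _ with third a₀ b
  ... | c , c≢a , c≢b = split
    where
    open DecMembership (_≟_ {N}) using (_∈?_)

    p : Society
    -- The alternative promoted last ranks first; those never promoted stay tied at the bottom.
    p k = if does (k ∈? js) then promote c (promote a₀ indifference)
          else if does (k ≟ j) then promote a₀ (promote b indifference)
          else promote b (promote c indifference)

    a≻b : ∀ {k} → k ∈ j ∷ js → _≻_ (p k) a₀ b
    a≻b {k} k∈ with k ∈? js | k ≟ j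
    ... | yes _    | _       = promote-≻ (promote a₀ indifference) (≢-sym c≢a) (≢-sym c≢b)
                                 (promote-top indifference b≢a)
    ... | no _     | yes _   = promote-top (promote b indifference) b≢a
    ... | no k∉js  | no k≢j  with k∈
    ...   | here k≡j   = contradiction k≡j k≢j
    ...   | there k∈js = contradiction k∈js k∉js

    c≻b : ∀ {k} → k ∈ js → _≻_ (p k) c b
    c≻b {k} k∈js with k ∈? js
    ... | yes _   = promote-top (promote a₀ indifference) (≢-sym c≢b)
    ... | no k∉js = contradiction k∈js k∉js

    b≻c : ∀ {k} → ¬ k ∈ js → _≻_ (p k) b c
    b≻c {k} k∉js with k ∈? js | k ≟ j
    ... | yes k∈js | _     = contradiction k∈js k∉js
    ... | no _     | yes _ = promote-≻ (promote b indifference) b≢a c≢a (promote-top indifference c≢b)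
    ... | no _     | no _  = promote-top (promote c indifference) c≢b

    a≻c : ∀ {k} → k ≡ j → _≻_ (p k) a₀ c
    a≻c {k} refl with k ∈? js | k ≟ k
    ... | yes j∈js | _      = contradiction j∈js j∉js
    ... | no _     | yes _  = promote-top (promote b indifference) c≢a
    ... | no _     | no k≢k = contradiction refl k≢k

    c≻a : ∀ {k} → k ≢ j → _≻_ (p k) c a₀
    c≻a {k} k≢j with k ∈? js | k ≟ j
    ... | _     | yes k≡j = contradiction k≡j k≢j
    ... | yes _ | no _    = promote-top (promote a₀ indifference) (≢-sym c≢a)
    ... | no _  | no _    = promote-≻ (promote c indifference) c≢b (≢-sym b≢a)
                              (promote-top indifference (≢-sym c≢a))

    split : AllDecisive (_≡ j) ⊎ AllDecisive (_∈ js)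
    split with Comparisons._≽?_ (outcome p) c a₀
    -- The whole group forces `a₀` above `b`. So either `c` is at least as good as `a₀` and then
    -- beats `b`, which only `js` wants, or `a₀` beats `c`, which only `j` wants.
    ... | yes c≽a = inj₂ (neutrality (_∈? js) c≢b
                      (almostDecisive (_∈? js) p c≻b b≻c
                        (≽-≻-trans (outcome p) (transitive p) c≽a (dec (≢-sym b≢a) p a≻b))))
    ... | no c⋡a  = inj₁ (neutrality (_≟ j) (≢-sym c≢a)
                      (almostDecisive (_≟ j) p a≻c c≻a (Comparisons.⋡⇒≻ (outcome p) c⋡a)))

  -- Contraction must stop at a single individual: the empty group would be vacuously decisive for a
  -- pair in both directions.
  descend : ∀ js → AllDecisive (_∈ js) → ∃[ j ] AllDecisive (_≡ j)
  descend [] dec with third a₀ a₀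
  ... | b , b≢a , _ = contradiction
    (proj₁ (dec b≢a (const indifference) λ ()))
    (proj₂ (dec (≢-sym b≢a) (const indifference) λ ()))
  descend (j ∷ js) dec = [ (j ,_) , descend js ]′ (contract j js dec)

  arrow : ∃[ j ] AllDecisive (_≡ j)
  arrow = descend (allFin N) λ _ p in-p → unanimity p _ _ λ j → in-p (∈-allFin j)

-- Exhaustive search through valid profiles.

module Search {A : Set} {n : ℕ} (finite : A ↔ Fin n) {N : ℕ} where

  open Inverse finite using (strictlyInverseʳ) renaming (to to index; from to element)
  open Lattice finite using (all?)

  -- Relations that are not weak orders get the junk value indifference.
  toWeakOrder : (R : Rel A 0ℓ) → Decidable R → WeakOrder A
  toWeakOrder R R? with (all? λ a → all? λ b → R? a b ⊎-dec R? b a)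
                      | (all? λ a → all? λ b → all? λ c → ¬? (R? a b ×-dec R? b c) ⊎-dec R? a c)
  ... | yes total | yes trans = mkWeakOrder R total
                                  (λ {a} {b} {c} ab bc → [ contradiction (ab , bc) , (λ ac → ac) ]′ (trans a b c)) R?
  ... | _         | _         = indifference

  -- `R` inherits totality and transitivity from `r`, so the junk value is never reached.
  toWeakOrder-≃ : ∀ {R} (R? : Decidable R) (r : WeakOrder A) →
                  (∀ a b → WeakOrder._≽_ r a b ⇔ R a b) → r ≃ toWeakOrder R R?
  toWeakOrder-≃ R? r r⇔R with (all? λ a → all? λ b → R? a b ⊎-dec R? b a)
                            | (all? λ a → all? λ b → all? λ c → ¬? (R? a b ×-dec R? b c) ⊎-dec R? a c)
  ... | yes _     | yes _  = r⇔R
  ... | yes _     | no ¬trans = contradiction transR ¬trans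
    where
    transR : ∀ a b c → _ ⊎ _
    transR a b c with R? a b | R? b c
    ... | no ¬ab | _      = inj₁ (¬ab ∘ proj₁)
    ... | yes _  | no ¬bc = inj₁ (¬bc ∘ proj₂)
    ... | yes ab | yes bc = inj₂ (to (r⇔R a c) (WeakOrder.trans r (from (r⇔R a b) ab) (from (r⇔R b c) bc)))
  ... | no ¬total | _      = contradiction
    (λ a b → Sum.map (to (r⇔R a b)) (to (r⇔R b a)) (WeakOrder.total r a b)) ¬total

  private
    -- Numbers the triples `(j , a , b)`. A profile is coded by the set of triples for which `j`
    -- finds `a` at least as good as `b`, hence by a subset of a finite set.
    position : Fin N → A → A → Fin (N * (n * n))
    position j a b = combine j (combine (index a) (index b))

    decode : Subset (N * (n * n)) → ValidProfile A N
    decode s j = toWeakOrder (λ a b → T (lookup s (position j a b))) (λ a b → T? _)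

    comparison? : (p : ValidProfile A N) → Fin N × Fin n × Fin n → Bool
    comparison? p (j , x , y) = ⌊ WeakOrder._≽?_ (p j) (element x) (element y) ⌋

    coordinates : Fin (N * (n * n)) → Fin N × Fin n × Fin n
    coordinates = map₂ (remQuot n) ∘ remQuot (n * n)

    coordinates-position : ∀ j a b → coordinates (position j a b) ≡ (j , index a , index b)
    coordinates-position j a b = trans
      (cong (map₂ (remQuot n)) (remQuot-combine j (combine (index a) (index b))))
      (cong (j ,_) (remQuot-combine (index a) (index b)))

    encode : ValidProfile A N → Subset (N * (n * n))
    encode p = tabulate (comparison? p ∘ coordinates)

    lookup-encode : ∀ p j a b →
      lookup (encode p) (position j a b) ≡ ⌊ WeakOrder._≽?_ (p j) a b ⌋
    lookup-encode p j a b = trans (lookup∘tabulate (comparison? p ∘ coordinates) (position j a b))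
      (trans (cong (comparison? p) (coordinates-position j a b))
        (cong₂ (λ a b → ⌊ WeakOrder._≽?_ (p j) a b ⌋) (strictlyInverseʳ a) (strictlyInverseʳ b)))

    decode-encode : ∀ p j → p j ≃ decode (encode p) j
    decode-encode p j = toWeakOrder-≃ _ (p j) λ a b →
      mk⇔ (subst T (sym (lookup-encode p j a b)) ∘ fromWitness)
          (toWitness ∘ subst T (lookup-encode p j a b))

  -- Every profile is recovered from its code up to `≃`, so testing all decoded subsets is
  -- exhaustive for a predicate that respects `≃`.
  anyProfile? : ∀ {ℓ} {P : ValidProfile A N → Set ℓ} → U.Decidable P →
    (∀ {p p′} → (∀ j → p j ≃ p′ j) → P p → P p′) → Dec (∃ P)
  anyProfile? P? resp = map′
    (λ (s , h) → decode s , h)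
    (λ (p , h) → encode p , resp (decode-encode p) h)
    (anySubset? (P? ∘ decode))

-- An alternative different from two given ones.

third : ∀ {n} → 3 ≤ n → (a b : Fin n) → ∃[ c ] c ≢ a × c ≢ b
third (s≤s (s≤s (s≤s _))) a b with a ≟ b
... | yes refl = punchIn a zero , punchInᵢ≢i a zero , punchInᵢ≢i a zero
-- With `a` removed, `b` becomes `punchOut a≢b`; `c` avoids that element, and `punchIn a` then
-- avoids `a`.
... | no a≢b   = punchIn a c , punchInᵢ≢i a c ,
  λ eq → punchInᵢ≢i (punchOut a≢b) zero
    (punchIn-injective a c (punchOut a≢b) (trans eq (sym (punchIn-punchOut a≢b))))
  where c = punchIn (punchOut a≢b) zero

third-↔ : ∀ {A : Set} {n} → A ↔ Fin n → 3 ≤ n → (a b : A) → ∃[ c ] c ≢ a × c ≢ b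
third-↔ finite 3≤n a b with third 3≤n (index a) (index b)
  where open Inverse finite renaming (to to index)
... | c , c≢a , c≢b = element c , (λ eq → c≢a (inverseˡ′ eq)) , λ eq → c≢b (inverseˡ′ eq)
  where
  open Inverse finite using (strictlyInverseˡ) renaming (to to index; from to element)
  inverseˡ′ : ∀ {a} → element c ≡ a → c ≡ index a
  inverseˡ′ eq = trans (sym (strictlyInverseˡ c)) (cong index eq)

-- Existence of a valid profile with contradictory outcome.

module _ {A : Set} {N : ℕ} {w : Aggregation A N} (ρ : Reading w) where

  open Reading ρ

  outcome-transitive : ∀ p → ¬ (Func.to w (valid p) ≈ 𝐜) → Transitive (Comparisons._≽_ (outcome p))
  outcome-transitive p w≉𝐜 {a} {b} {c} ab bc with Func.to w (valid p) | represents p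
  ... | 𝐜     | _    = contradiction AddEquality.⊥₋≈⊥₋ w≉𝐜
  ... | [ r ] | same =
    from (proj₁ (same a c)) (WeakOrder.trans r (to (proj₁ (same a b)) ab) (to (proj₁ (same b c)) bc))

  -- Turns decisiveness, a statement about the reading, into the strictness order demanded of a
  -- dictator.
  outcome-≤ : ∀ p r → (∀ {a b} → _≻_ r a b → Comparisons._≻_ (outcome p) a b) →
              Defs._≤_ (Func.to w (valid p)) [ r ]
  outcome-≤ p r r⇒outcome with Func.to w (valid p) | represents p
  ... | 𝐜     | _    = 𝐜≤ [ r ]
  ... | [ s ] | same = ≤[ (λ {a} {b} a≻b →
    ≻-resp (outcome p) (comparisons s) (same a b) (r⇒outcome a≻b)) ]

≈𝐜? : ∀ {A} → U.Decidable (λ (r : P̲ A) → r ≈ 𝐜)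
≈𝐜? 𝐜     = yes AddEquality.⊥₋≈⊥₋
≈𝐜? [ _ ] = no λ ()

contradictoryProfile : ∀ {A : Set} {n} (finite : A ↔ Fin n) → 3 ≤ n →
  ∀ {N} {w : Aggregation A N} (ρ : Reading w) →
  Unanimity ρ → IIA ρ → NonDictatorship w → ∃[ p ] Func.to w (valid p) ≈ 𝐜
contradictoryProfile {A} finite 3≤n@(s≤s _) {N} {w} ρ unanimity iia nonDictatorship
  with Search.anyProfile? finite (λ p → ≈𝐜? (Func.to w (valid p)))
         (λ {p} {p′} p≃p′ → P̲.trans (Func.cong w λ j → AddEquality.[ ≃.sym {p j} {p′ j} (p≃p′ j) ]))
  where
  module P̲ = IsEquivalence (liftEquivalence {A} ≃-isEquivalence)
  module ≃ = IsEquivalence (≃-isEquivalence {A})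
... | yes found = found
... | no ¬found = contradiction (j , dictates) nonDictatorship
  where
  arrow : ∃[ j ] _
  -- The match on `3≤n` makes `n` a successor, so `zero` names a base alternative.
  arrow = Arrow.arrow (via-injection (↔⇒↣ finite) _≟_) (third-↔ finite 3≤n) (Inverse.from finite zero)
    ρ unanimity iia (λ p → outcome-transitive ρ p λ w≈𝐜 → ¬found (p , w≈𝐜))

  j = proj₁ arrow

  dictates : Dictator w j
  -- The first clause is vacuous, as no outcome is `𝐜`; the second holds because `{j}` is decisive
  -- for every pair of distinct alternatives.
  dictates p = (λ w≈𝐜 → contradiction (p , w≈𝐜) ¬found) ,
    λ _ → outcome-≤ ρ p (p j) λ a≻b →
      proj₂ arrow (≻-irrefl (comparisons (p j)) a≻b) p λ { refl → a≻b }

-- From a contradictory outcome to the quasi-Gödelian property.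

module _ {A : Set} {n : ℕ} (finite : A ↔ Fin n) {N : ℕ} (w : Aggregation A N) where

  open Lattice finite
  open SelfReference finite {N}

  not-quasi-consistent-and-complete : ∀ Ω′ e q → valid q ≤ᴺ ~ᴺ (_∗_ w Ω′ e (valid q)) →
    ¬ (QuasiConsistent w Ω′ e (valid q) × QuasiComplete w Ω′ e (valid q))
  not-quasi-consistent-and-complete _ _ q q≤ (q≤′ , j , meet≈𝐜)
    with P̲.trans (proj₂ (proj₂ (∧-infimum _ _)) [ q j ] (q≤ j) (q≤′ j)) (P̲.reflexive meet≈𝐜)
    where module P̲ = IsPartialOrder (≤-isPartialOrder {A})
  -- `[ q j ]` would lie below `𝐜`, which no valid element does.
  ... | ()

  contradictory⇒≤¬Υ : ∀ i q → Func.to w q ≈ 𝐜 → q ≤ᴺ ~ᴺ (_∗_ w (Ω i) (Υ i) q)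
  contradictory⇒≤¬Υ i q w≈𝐜 j with j ≟ i
  -- Off position `i` the entry of `Υ i ∗ q` is the padding `𝐜`, whose negation is the top element.
  ... | no j≢i
    rewrite updateAt-minimal j i {const (Υ i i ∧ Func.to w q)} (replicate N 𝐜) j≢i = 𝐢-maximum (q j)
  ... | yes refl
    rewrite updateAt-updates i {const (Υ i i ∧ Func.to w q)} (replicate N 𝐜)
          | updateAt-updates i {const 𝐢} (replicate {A = P̲ A} N 𝐜)
    -- The entry at `i` is now `𝐢 ∧ w q`; once the outcome is matched as `𝐜`, the meet is `𝐜` and
    -- its negation again `𝐢`.
    with Func.to w q | w≈𝐜
  ... | 𝐜 | _ = 𝐢-maximum (q j)

theorem11 : (A : Set) (n : ℕ) (finite : A ↔ Fin n) → 3 ≤ n →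
    (N : ℕ) → 2 ≤ N → (i : Fin N) →
    (w : Aggregation A N) (ρ : Reading w) →
    Unanimity ρ → IIA ρ → NonDictatorship w →
    SelfReference.QuasiGödelian finite w (SelfReference.Ω finite i) (SelfReference.Υ finite i)
theorem11 A n finite 3≤n N _ i w ρ unanimity iia nonDictatorship
  with contradictoryProfile finite 3≤n ρ unanimity iia nonDictatorship
... | q , w≈𝐜 = q , q≤ , not-quasi-consistent-and-complete finite w (Ω i) (Υ i) q q≤
  where
  open SelfReference finite using (Ω; Υ)
  q≤ = contradictory⇒≤¬Υ finite w i (valid q) w≈𝐜
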